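{- For every group $G$ of a metric grouping with tolerance $\delta$ (with representative value $\widehat v$ and $w^-=\min_{i\in G}w_i$, $w^+=\max_{i\in G}w_i$) and every share $c\in[0,F^w_G]$, $$\Delta_G(c)\ \le\ \widehat v\,U_G\,\frac{w^+-w^- }{w^++w^- }+\varepsilon_vU_G\ \le\ |G|\Bigl(\widehat v\,\frac{w^+-w^- }{w^++w^- }+\varepsilon_v\Bigr)\ \le\ |G|\Bigl(\frac{\widehat v\,L_w}{w_{\min}}+L_v\Bigr)\delta\ =\ \mathcal O(\delta).$$
   Context: $[n]=\{0,\dots,n-1\}$; each item $i\in[n]$ has a ceiling $u_i\in[0,1]$ and an attribute $a_i$ in a metric space $(A,d)$. There are functions $v:A\to(0,v_{\max}]$ and $w:A\to[w_{\min},\infty)$, $w_{\min}>0$, Lipschitz with constants $L_v$ and $L_w$ respectively, and item $i$ has value $v_i=v(a_i)$ and cost $w_i=w(a_i)$. A metric grouping with tolerance $\delta>0$ is a partition $\{G_0,\dots,G_{m-1}\}$ of $[n]$ into non-empty sets with representatives $\widehat a_k\in A$ such that $d(a_i,\widehat a_k)\le\delta$ for all $i\in G_k$. For a group $G$ with representative $\widehat a$: $\widehat v=v(\widehat a)$, and $\varepsilon_v:=L_v\delta$. $U_G=\sum_{i\in G}u_i$, $F^w_G=\sum_{i\in G}w_iu_i$. For $c\in[0,F^w_G]$, the water-filling allocation $z^{\mathrm{wf}}(c)\in\mathbb R^G$ is $z^{\mathrm{wf}}_i=\min\{u_i,\zeta\}$ with $\zeta$ the unique solution in $[0,\max_{i\in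 G}u_i]$ of $\sum_{i\in G}w_i\min\{u_i,\zeta\}=c$. Let $z^G$ be an optimal allocation of the same share among the items of $G$, i.e. a maximizer of $\sum_{i\in G}v_iz_i$ over $0\le z_i\le u_i$, $\sum_{i\in G}w_iz_i\le c$. The intra-group loss is $\Delta_G(c)=\sum_{i\in G}v_iz^G_i-\sum_{i\in G}v_iz^{\mathrm{wf}}_i$. -}

module Defs where

open import Algebra.Bundles using (CommutativeRing)
open import Algebra.Core using (Op₁; Op₂)
open import Algebra.Structures using (IsCommutativeRing)
import Algebra.Construct.NaturalChoice.Max as Max
import Algebra.Construct.NaturalChoice.Min as Min
import Algebra.Definitions.RawMonoid as RawMonoidDefs
open import Data.Bool.Base using (if_then_else_)
open import Data.Fin.Base using (Fin)
open import Data.Fin.Subset using (Subset; Nonempty; _∈_)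
open import Data.Nat.Base using (ℕ)
open import Data.Product.Base using (∃; ∃-syntax; _×_)
open import Data.Product using (∃!)
open import Data.Vec.Base using (lookup)
open import Function.Metric.Structures using (IsGeneralMetric)
open import Level using (suc; _⊔_)
open import Relation.Binary.Bundles using (TotalOrder)
open import Relation.Binary.Core using (Rel)
open import Relation.Binary.PropositionalEquality.Core using (_≡_)
open import Relation.Binary.Structures using (IsTotalOrder)
open import Relation.Nullary.Negation using (¬_)
open import Relation.Unary using (Pred)

-- Inversion is total, with an unspecified value at zero, so that division
-- carries no proof argument; every denominator used below is positive.
record OrderedField c ℓ₁ ℓ₂ : Set (suc (c ⊔ ℓ₁ ⊔ ℓ₂)) where
  infix  9 _⁻¹
  infix  8 -_
  infixl 7 _*_ _/_
  infixl 6 _+_ _-_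
  infix  4 _≈_ _≤_ _<_
  field
    Carrier           : Set c
    _≈_               : Rel Carrier ℓ₁
    _≤_               : Rel Carrier ℓ₂
    _+_ _*_           : Op₂ Carrier
    -_ _⁻¹            : Op₁ Carrier
    0# 1#             : Carrier
    isCommutativeRing : IsCommutativeRing _≈_ _+_ _*_ -_ 0# 1#
    isTotalOrder      : IsTotalOrder _≈_ _≤_
    1≉0               : ¬ (1# ≈ 0#)
    ⁻¹-cong           : ∀ {x y} → x ≈ y → x ⁻¹ ≈ y ⁻¹
    *-inverseʳ        : ∀ x → ¬ (x ≈ 0#) → x * x ⁻¹ ≈ 1#
    +-monoˡ-≤         : ∀ z {x y} → x ≤ y → x + z ≤ y + z
    *-nonNeg          : ∀ {x y} → 0# ≤ x → 0# ≤ y → 0# ≤ x * y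

  commutativeRing : CommutativeRing c ℓ₁
  commutativeRing = record { isCommutativeRing = isCommutativeRing }

  totalOrder : TotalOrder c ℓ₁ ℓ₂
  totalOrder = record { isTotalOrder = isTotalOrder }

  open Min totalOrder public using (_⊓_)
  open Max totalOrder public using () renaming (_⊔_ to _∨_)
  open RawMonoidDefs (CommutativeRing.+-rawMonoid commutativeRing) public
    using (sum) renaming (_×_ to _·_)

  _<_ : Rel Carrier (ℓ₁ ⊔ ℓ₂)
  x < y = x ≤ y × ¬ (x ≈ y)

  _-_ _/_ : Op₂ Carrier
  x - y = x + - y
  x / y = x * y ⁻¹

  abs : Op₁ Carrier
  abs x = x ∨ - x

  fromℕ : ℕ → Carrier
  fromℕ k = k · 1#

  UpperBound : ∀ {p} → Pred Carrier p → Pred Carrier (c ⊔ ℓ₂ ⊔ p)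
  UpperBound P b = ∀ x → P x → x ≤ b

  infix 5 sumOver
  sumOver : ∀ {n} → Subset n → (Fin n → Carrier) → Carrier
  sumOver G f = sum (λ i → if lookup G i then f i else 0#)

  syntax sumOver G (λ i → e) = ∑[ i ∈ G ] e

  IsMinimum IsMaximum : ∀ {n} → Subset n → (Fin n → Carrier) → Pred Carrier (ℓ₁ ⊔ ℓ₂)
  IsMinimum G f x = (∃[ i ] i ∈ G × x ≈ f i) × (∀ i → i ∈ G → x ≤ f i)
  IsMaximum G f x = (∃[ i ] i ∈ G × x ≈ f i) × (∀ i → i ∈ G → f i ≤ x)

-- The real numbers, given by their axioms: classically, a Dedekind-complete
-- ordered field is unique up to unique isomorphism.
record Reals c ℓ₁ ℓ₂ : Set (suc (c ⊔ ℓ₁ ⊔ ℓ₂)) where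
  field
    orderedField : OrderedField c ℓ₁ ℓ₂

  open OrderedField orderedField public

  field
    supremum : (P : Pred Carrier (c ⊔ ℓ₁ ⊔ ℓ₂)) → ∃ P → ∃ (UpperBound P) →
               ∃[ s ] UpperBound P s × (∀ b → UpperBound P b → s ≤ b)

module _ {c ℓ₁ ℓ₂} (ℝ : Reals c ℓ₁ ℓ₂) where
  open Reals ℝ

  record MetricSpace a ℓ : Set (c ⊔ ℓ₁ ⊔ ℓ₂ ⊔ suc (a ⊔ ℓ)) where
    field
      Point    : Set a
      _≈ₚ_     : Rel Point ℓ
      d        : Point → Point → Carrier
      isMetric : IsGeneralMetric _≈ₚ_ _≈_ _≤_ 0# _+_ d

    IsLipschitz : Carrier → (Point → Carrier) → Set (a ⊔ ℓ₂)
    IsLipschitz L f = 0# ≤ L × (∀ x y → abs (f x - f y) ≤ L * d x y)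

  record Instance a ℓ : Set (c ⊔ ℓ₁ ⊔ ℓ₂ ⊔ suc (a ⊔ ℓ)) where
    field
      space : MetricSpace a ℓ

    open MetricSpace space public

    field
      vmax wmin Lᵥ L_w : Carrier
      v w         : Point → Carrier
      0<wmin      : 0# < wmin
      0<v         : ∀ x → 0# < v x
      v≤vmax      : ∀ x → v x ≤ vmax
      wmin≤w      : ∀ x → wmin ≤ w x
      v-lipschitz : IsLipschitz Lᵥ v
      w-lipschitz : IsLipschitz L_w w
      n           : ℕ
      u           : Fin n → Carrier
      0≤u         : ∀ i → 0# ≤ u i
      u≤1         : ∀ i → u i ≤ 1#
      attribute   : Fin n → Point

    value cost : Fin n → Carrier
    value i = v (attribute i)
    cost  i = w (attribute i)

    record MetricGrouping (δ : Carrier) : Set (a ⊔ ℓ₁ ⊔ ℓ₂) where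
      field
        0<δ       : 0# < δ
        m         : ℕ
        group     : Fin m → Subset n
        nonempty  : ∀ k → Nonempty (group k)
        partition : ∀ i → ∃! _≡_ (λ k → i ∈ group k)
        rep       : Fin m → Point
        close     : ∀ k i → i ∈ group k → d (attribute i) (rep k) ≤ δ

    -- An allocation is indexed by all items; for a group G only its
    -- restriction to G is ever used, so it stands for a vector in ℝ^G.
    Allocation : Set c
    Allocation = Fin n → Carrier

    totalCeiling fullCost : Subset n → Carrier
    totalCeiling G = ∑[ i ∈ G ] u i
    fullCost     G = ∑[ i ∈ G ] (cost i * u i)

    totalValue totalCost : Subset n → Allocation → Carrier
    totalValue G z = ∑[ i ∈ G ] (value i * z i)
    totalCost  G z = ∑[ i ∈ G ] (cost i * z i)

    IsFeasible : Subset n → Carrier → Allocation → Set ℓ₂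
    IsFeasible G s z = (∀ i → i ∈ G → 0# ≤ z i × z i ≤ u i) × totalCost G z ≤ s

    IsOptimal : Subset n → Carrier → Allocation → Set (c ⊔ ℓ₂)
    IsOptimal G s z =
      IsFeasible G s z × (∀ z′ → IsFeasible G s z′ → totalValue G z′ ≤ totalValue G z)

    waterFill : Carrier → Allocation
    waterFill ζ i = u i ⊓ ζ

    IsWaterLevel : Subset n → Carrier → Carrier → Set (c ⊔ ℓ₁ ⊔ ℓ₂)
    IsWaterLevel G s ζ =
      0# ≤ ζ × (∃[ u⁺ ] IsMaximum G u u⁺ × ζ ≤ u⁺) × totalCost G (waterFill ζ) ≈ s

    intraGroupLoss : Subset n → Allocation → Carrier → Carrier
    intraGroupLoss G z ζ = totalValue G z - totalValue G (waterFill ζ)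

{-# OPTIONS --safe #-}

-- Linear programming duality inside one group. With ρ = (w⁺ − w⁻) / (w⁺ + w⁻)
-- and the price λ = 2 v̂ / (w⁺ + w⁻) of cost, λ wᵢ lies within v̂ ρ of v̂, hence
-- within κ = v̂ ρ + εᵥ of vᵢ. Both zᵢ and the water-filling yᵢ lie in [0 , uᵢ], so
--   (vᵢ − λ wᵢ) (zᵢ − yᵢ) ≤ κ uᵢ.
-- Summing over the group, the cost terms only help: water-filling spends
-- exactly the share, and z at most the share.
module Submission where

open import Defs
open import Algebra.Bundles using (CommutativeRing)
import Algebra.Construct.NaturalChoice.Max as Max
import Algebra.Construct.NaturalChoice.Min as Min
import Algebra.Properties.Ring as RingProperties
import Algebra.Solver.Ring.NaturalCoefficients.Default as Solver
open import Data.Bool.Base using (true; false)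
open import Data.Empty using (⊥-elim)
open import Data.Fin.Base using (Fin; zero; suc)
open import Data.Fin.Subset using (Subset; ∣_∣; _∈_)
open import Data.Fin.Subset.Properties using (∣p∣≤n)
open import Data.Nat.Base as ℕ using (z≤n; s≤s)
open import Data.Product using (_×_; ∃-syntax; _,_; proj₁; proj₂)
open import Data.Sum.Base using (inj₁; inj₂)
open import Data.Vec.Base using ([]; _∷_; here; there)
open import Function.Base using (_∘_)
import Relation.Binary.Reasoning.PartialOrder as PartialOrderReasoning
open import Relation.Binary.Bundles using (TotalOrder)
open import Relation.Nullary.Negation using (¬_)

module OrderedFieldProperties {c ℓ₁ ℓ₂} (F : OrderedField c ℓ₁ ℓ₂) where
  open OrderedField F
  open CommutativeRing commutativeRing
    using (ring; commutativeSemiring; refl; sym; trans;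
           +-cong; +-congˡ; +-congʳ; +-comm; +-assoc; +-identityˡ; +-identityʳ;
           -‿cong; -‿inverseˡ; -‿inverseʳ; *-congˡ; *-comm; *-assoc;
           *-identityʳ; zeroʳ; distribˡ)
  open TotalOrder totalOrder
    using (poset; total; antisym)
    renaming (refl to ≤-refl; reflexive to ≤-reflexive; trans to ≤-trans)
  open RingProperties ring using (-‿distribʳ-*; -‿involutive)
  open Solver commutativeSemiring using (solve; _:+_; _:*_; _:=_)
  open PartialOrderReasoning poset

  -- Additive order arithmetic.

  [y-x]+x≈y : ∀ x y → (y - x) + x ≈ y
  [y-x]+x≈y x y = trans (+-assoc y (- x) x) (trans (+-congˡ (-‿inverseˡ x)) (+-identityʳ y))

  x+[y-x]≈y : ∀ x y → x + (y - x) ≈ y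
  x+[y-x]≈y x y = trans (+-comm x (y - x)) ([y-x]+x≈y x y)

  [x+y]-y≈x : ∀ x y → (x + y) - y ≈ x
  [x+y]-y≈x x y = trans (+-assoc x y (- y)) (trans (+-congˡ (-‿inverseʳ y)) (+-identityʳ x))

  +-monoʳ-≤ : ∀ z {x y} → x ≤ y → z + x ≤ z + y
  +-monoʳ-≤ z {x} {y} x≤y = begin
    z + x ≈⟨ +-comm z x ⟩
    x + z ≤⟨ +-monoˡ-≤ z x≤y ⟩
    y + z ≈⟨ +-comm y z ⟩
    z + y ∎

  +-mono-≤ : ∀ {x y z t} → x ≤ y → z ≤ t → x + z ≤ y + t
  +-mono-≤ {y = y} {z} x≤y z≤t = ≤-trans (+-monoˡ-≤ z x≤y) (+-monoʳ-≤ y z≤t)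

  +-nonNeg : ∀ {x y} → 0# ≤ x → 0# ≤ y → 0# ≤ x + y
  +-nonNeg {x} {y} 0≤x 0≤y = begin
    0#      ≈⟨ +-identityʳ 0# ⟨
    0# + 0# ≤⟨ +-mono-≤ 0≤x 0≤y ⟩
    x + y   ∎

  +-cancelʳ-≤ : ∀ z {x y} → x + z ≤ y + z → x ≤ y
  +-cancelʳ-≤ z {x} {y} x+z≤y+z = begin
    x           ≈⟨ [x+y]-y≈x x z ⟨
    (x + z) - z ≤⟨ +-monoˡ-≤ (- z) x+z≤y+z ⟩
    (y + z) - z ≈⟨ [x+y]-y≈x y z ⟩
    y           ∎

  x≤y⇒0≤y-x : ∀ {x y} → x ≤ y → 0# ≤ y - x
  x≤y⇒0≤y-x {x} {y} x≤y = begin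
    0#    ≈⟨ -‿inverseʳ x ⟨
    x - x ≤⟨ +-monoˡ-≤ (- x) x≤y ⟩
    y - x ∎

  x≤y+z⇒x-y≤z : ∀ {x y z} → x ≤ y + z → x - y ≤ z
  x≤y+z⇒x-y≤z {x} {y} {z} x≤y+z = +-cancelʳ-≤ y (begin
    (x - y) + y ≈⟨ [y-x]+x≈y y x ⟩
    x           ≤⟨ x≤y+z ⟩
    y + z       ≈⟨ +-comm y z ⟩
    z + y       ∎)

  -- Turns an inequality into an equation with a nonnegative remainder `d`, so that later products
  -- can be expanded by the semiring solver, which works without subtraction.
  ≤-split : ∀ {x y} → x ≤ y → ∃[ d ] 0# ≤ d × y ≈ x + d
  ≤-split {x} {y} x≤y = y - x , x≤y⇒0≤y-x x≤y , sym (x+[y-x]≈y x y)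

  x≤x+y : ∀ {x y} → 0# ≤ y → x ≤ x + y
  x≤x+y {x} {y} 0≤y = begin
    x      ≈⟨ +-identityʳ x ⟨
    x + 0# ≤⟨ +-monoʳ-≤ x 0≤y ⟩
    x + y  ∎

  -- Products, inverses and quotients.

  *-monoˡ-≤ : ∀ {z} → 0# ≤ z → ∀ {x y} → x ≤ y → z * x ≤ z * y
  *-monoˡ-≤ {z} 0≤z {x} {y} x≤y with ≤-split x≤y
  ... | d , 0≤d , y≈x+d = begin
    z * x         ≤⟨ x≤x+y (*-nonNeg 0≤z 0≤d) ⟩
    z * x + z * d ≈⟨ distribˡ z x d ⟨
    z * (x + d)   ≈⟨ *-congˡ y≈x+d ⟨
    z * y         ∎

  *-monoʳ-≤ : ∀ {z} → 0# ≤ z → ∀ {x y} → x ≤ y → x * z ≤ y * z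
  *-monoʳ-≤ {z} 0≤z {x} {y} x≤y = begin
    x * z ≈⟨ *-comm x z ⟩
    z * x ≤⟨ *-monoˡ-≤ 0≤z x≤y ⟩
    z * y ≈⟨ *-comm z y ⟩
    y * z ∎

  x≤0⇒0≤-x : ∀ {x} → x ≤ 0# → 0# ≤ - x
  x≤0⇒0≤-x {x} x≤0 = ≤-trans (x≤y⇒0≤y-x x≤0) (≤-reflexive (+-identityˡ (- x)))

  0≤1 : 0# ≤ 1#
  0≤1 with total 0# 1#
  ... | inj₁ 0≤1 = 0≤1
  ... | inj₂ 1≤0 = begin
    -- If `1# ≤ 0#`, then `- 1#` is nonnegative, and so is its square, which is `1#`.
    0#             ≤⟨ *-nonNeg (x≤0⇒0≤-x 1≤0) (x≤0⇒0≤-x 1≤0) ⟩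
    (- 1#) * - 1#  ≈⟨ -‿distribʳ-* (- 1#) 1# ⟨
    - (- 1# * 1#)  ≈⟨ -‿cong (*-identityʳ (- 1#)) ⟩
    - (- 1#)       ≈⟨ -‿involutive 1# ⟩
    1#             ∎

  pos⇒≉0 : ∀ {x} → 0# < x → ¬ (x ≈ 0#)
  pos⇒≉0 (_ , 0≉x) x≈0 = 0≉x (sym x≈0)

  <-≤-trans : ∀ {x y z} → x < y → y ≤ z → x < z
  <-≤-trans (x≤y , x≉y) y≤z =
    ≤-trans x≤y y≤z , λ x≈z → x≉y (antisym x≤y (≤-trans y≤z (≤-reflexive (sym x≈z))))

  ⁻¹-nonNeg : ∀ {x} → 0# < x → 0# ≤ x ⁻¹
  ⁻¹-nonNeg {x} 0<x with total 0# (x ⁻¹)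
  ... | inj₁ 0≤x⁻¹ = 0≤x⁻¹
  -- A nonpositive inverse would make `x * x ⁻¹`, which is `1#`, nonpositive too, forcing `1# ≈ 0#`.
  ... | inj₂ x⁻¹≤0 = ⊥-elim (1≉0 (antisym 1≤0 0≤1))
    where
    1≤0 : 1# ≤ 0#
    1≤0 = begin
      1#       ≈⟨ *-inverseʳ x (pos⇒≉0 0<x) ⟨
      x * x ⁻¹ ≤⟨ *-monoˡ-≤ (proj₁ 0<x) x⁻¹≤0 ⟩
      x * 0#   ≈⟨ zeroʳ x ⟩
      0#       ∎

  /-nonNeg : ∀ {x y} → 0# ≤ x → 0# < y → 0# ≤ x / y
  /-nonNeg 0≤x 0<y = *-nonNeg 0≤x (⁻¹-nonNeg 0<y)

  x/y*y≈x : ∀ x {y} → 0# < y → x / y * y ≈ x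
  x/y*y≈x x {y} 0<y = begin-equality
    x * y ⁻¹ * y   ≈⟨ *-assoc x (y ⁻¹) y ⟩
    x * (y ⁻¹ * y) ≈⟨ *-congˡ (trans (*-comm (y ⁻¹) y) (*-inverseʳ y (pos⇒≉0 0<y))) ⟩
    x * 1#         ≈⟨ *-identityʳ x ⟩
    x              ∎

  x≤y*z⇒x/z≤y : ∀ {x y z} → 0# < z → x ≤ y * z → x / z ≤ y
  x≤y*z⇒x/z≤y {x} {y} {z} 0<z x≤y*z = begin
    x * z ⁻¹       ≤⟨ *-monoʳ-≤ (⁻¹-nonNeg 0<z) x≤y*z ⟩
    y * z * z ⁻¹   ≈⟨ *-assoc y z (z ⁻¹) ⟩
    y * (z * z ⁻¹) ≈⟨ *-congˡ (*-inverseʳ z (pos⇒≉0 0<z)) ⟩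
    y * 1#         ≈⟨ *-identityʳ y ⟩
    y              ∎

  -- Absolute values, minima and natural multiples.

  abs-nonNeg : ∀ {x} → 0# ≤ x → abs x ≤ x
  abs-nonNeg {x} 0≤x = Max.⊔-lub totalOrder ≤-refl (begin
    - x    ≈⟨ +-identityˡ (- x) ⟨
    0# - x ≤⟨ +-monoˡ-≤ (- x) 0≤x ⟩
    x - x  ≈⟨ -‿inverseʳ x ⟩
    0#     ≤⟨ 0≤x ⟩
    x      ∎)

  abs[x-y]≤z⇒x≤y+z : ∀ {x y z} → abs (x - y) ≤ z → x ≤ y + z
  abs[x-y]≤z⇒x≤y+z {x} {y} {z} ∣x-y∣≤z = begin
    x               ≈⟨ x+[y-x]≈y y x ⟨
    y + (x - y)     ≤⟨ +-monoʳ-≤ y (Max.x≤x⊔y totalOrder (x - y) (- (x - y))) ⟩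
    y + abs (x - y) ≤⟨ +-monoʳ-≤ y ∣x-y∣≤z ⟩
    y + z           ∎

  abs[x-y]≤z⇒y≤x+z : ∀ {x y z} → abs (x - y) ≤ z → y ≤ x + z
  abs[x-y]≤z⇒y≤x+z {x} {y} {z} ∣x-y∣≤z = begin
    y                             ≈⟨ [x+y]-y≈x y (x - y) ⟨
    (y + (x - y)) - (x - y)       ≈⟨ +-congʳ (x+[y-x]≈y y x) ⟩
    x + - (x - y)                 ≤⟨ +-monoʳ-≤ x (Max.x≤y⊔x totalOrder (x - y) (- (x - y))) ⟩
    x + abs (x - y)               ≤⟨ +-monoʳ-≤ x ∣x-y∣≤z ⟩
    x + z                         ∎

  ⊓-nonNeg : ∀ {x y} → 0# ≤ x → 0# ≤ y → 0# ≤ x ⊓ y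
  ⊓-nonNeg = Min.⊓-glb totalOrder

  ⊓-≤ˡ : ∀ x y → x ⊓ y ≤ x
  ⊓-≤ˡ = Min.x⊓y≤x totalOrder

  fromℕ-nonNeg : ∀ k → 0# ≤ fromℕ k
  fromℕ-nonNeg ℕ.zero    = ≤-refl
  fromℕ-nonNeg (ℕ.suc k) = +-nonNeg 0≤1 (fromℕ-nonNeg k)

  fromℕ-mono-≤ : ∀ {j k} → j ℕ.≤ k → fromℕ j ≤ fromℕ k
  fromℕ-mono-≤ {k = k} z≤n = fromℕ-nonNeg k
  fromℕ-mono-≤ (s≤s j≤k)   = +-monoʳ-≤ 1# (fromℕ-mono-≤ j≤k)

  -- Sums over a subset, by induction on its membership vector.

  sumOver-mono : ∀ {n} (G : Subset n) {f g : Fin n → Carrier} →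
                 (∀ i → i ∈ G → f i ≤ g i) → sumOver G f ≤ sumOver G g
  sumOver-mono []          f≤g = ≤-refl
  sumOver-mono (true ∷ G)  f≤g =
    +-mono-≤ (f≤g zero here) (sumOver-mono G (λ i i∈G → f≤g (suc i) (there i∈G)))
  -- An index outside `G` is not skipped but contributes `0#`, so a leading `0# +` remains to be
  -- carried or removed.
  sumOver-mono (false ∷ G) f≤g =
    +-monoʳ-≤ 0# (sumOver-mono G (λ i i∈G → f≤g (suc i) (there i∈G)))

  sumOver-+ : ∀ {n} (G : Subset n) (f g : Fin n → Carrier) →
              sumOver G (λ i → f i + g i) ≈ sumOver G f + sumOver G g
  sumOver-+ []          f g = sym (+-identityʳ 0#)
  sumOver-+ (true ∷ G)  f g =
    trans (+-congˡ (sumOver-+ G (f ∘ suc) (g ∘ suc)))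
      (solve 4 (λ a b s t → (a :+ b) :+ (s :+ t) := (a :+ s) :+ (b :+ t)) refl
        (f zero) (g zero) (sumOver G (f ∘ suc)) (sumOver G (g ∘ suc)))
  sumOver-+ (false ∷ G) f g =
    trans (+-identityˡ _) (trans (sumOver-+ G (f ∘ suc) (g ∘ suc))
      (sym (+-cong (+-identityˡ _) (+-identityˡ _))))

  sumOver-*ˡ : ∀ {n} (G : Subset n) a (f : Fin n → Carrier) →
               sumOver G (λ i → a * f i) ≈ a * sumOver G f
  sumOver-*ˡ []          a f = sym (zeroʳ a)
  sumOver-*ˡ (true ∷ G)  a f =
    trans (+-congˡ (sumOver-*ˡ G a (f ∘ suc))) (sym (distribˡ a (f zero) _))
  sumOver-*ˡ (false ∷ G) a f =
    trans (+-identityˡ _) (trans (sumOver-*ˡ G a (f ∘ suc)) (*-congˡ (sym (+-identityˡ _))))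

  sumOver-≤-∣∣ : ∀ {n} (G : Subset n) (f : Fin n → Carrier) →
                 (∀ i → f i ≤ 1#) → sumOver G f ≤ fromℕ ∣ G ∣
  sumOver-≤-∣∣ []          f f≤1 = ≤-refl
  sumOver-≤-∣∣ (true ∷ G)  f f≤1 = +-mono-≤ (f≤1 zero) (sumOver-≤-∣∣ G (f ∘ suc) (f≤1 ∘ suc))
  sumOver-≤-∣∣ (false ∷ G) f f≤1 =
    ≤-trans (≤-reflexive (+-identityˡ _)) (sumOver-≤-∣∣ G (f ∘ suc) (f≤1 ∘ suc))

  -- The exchange inequality and its sum over a group.

  -- A subtraction-free form of `(a - b) * (x - y) ≤ g * u`. With `x ≈ y + d` the two sides differ
  -- only in terms carrying `d`: there `a` is at most `b + g`, and `d ≤ x ≤ u` because `y` is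
  -- nonnegative.
  swap-ordered : ∀ {a b g x y u} → a ≤ b + g → 0# ≤ g → 0# ≤ y → y ≤ x → x ≤ u →
                 a * x + b * y ≤ a * y + b * x + g * u
  swap-ordered {a} {b} {g} {x} {y} {u} a≤b+g 0≤g 0≤y y≤x x≤u with ≤-split y≤x
  ... | d , 0≤d , x≈y+d = begin
    a * x + b * y                   ≈⟨ +-congʳ (*-congˡ x≈y+d) ⟩
    a * (y + d) + b * y             ≈⟨ solve 4 (λ a b y d → a :* (y :+ d) :+ b :* y
                                         := a :* d :+ (a :* y :+ b :* y)) refl a b y d ⟩
    a * d + (a * y + b * y)         ≤⟨ +-monoˡ-≤ _ (*-monoʳ-≤ 0≤d a≤b+g) ⟩
    (b + g) * d + (a * y + b * y)   ≈⟨ solve 5 (λ a b g y d → (b :+ g) :* d :+ (a :* y :+ b :* y)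
                                         := a :* y :+ b :* (y :+ d) :+ g :* d) refl a b g y d ⟩
    a * y + b * (y + d) + g * d     ≈⟨ +-congʳ (+-congˡ (*-congˡ x≈y+d)) ⟨
    a * y + b * x + g * d           ≤⟨ +-monoʳ-≤ _ (*-monoˡ-≤ 0≤g d≤u) ⟩
    a * y + b * x + g * u           ∎
    where
    d≤u : d ≤ u
    d≤u = begin
      d     ≤⟨ x≤x+y 0≤y ⟩
      d + y ≈⟨ +-comm d y ⟩
      y + d ≈⟨ x≈y+d ⟨
      x     ≤⟨ x≤u ⟩
      u     ∎

  -- The product `(a - b) * (x - y)` is unchanged when `a`, `x` trade places with `b`, `y`.
  -- Closeness of `a` and `b` in both directions therefore covers either order of `x` and `y`.
  swap-≤ : ∀ {a b g x y u} → a ≤ b + g → b ≤ a + g → 0# ≤ g →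
           0# ≤ x → x ≤ u → 0# ≤ y → y ≤ u →
           a * x + b * y ≤ a * y + b * x + g * u
  swap-≤ {a} {b} {g} {x} {y} {u} a≤b+g b≤a+g 0≤g 0≤x x≤u 0≤y y≤u with total y x
  ... | inj₁ y≤x = swap-ordered a≤b+g 0≤g 0≤y y≤x x≤u
  ... | inj₂ x≤y = begin
    a * x + b * y         ≈⟨ +-comm (a * x) (b * y) ⟩
    b * y + a * x         ≤⟨ swap-ordered b≤a+g 0≤g 0≤x x≤y y≤u ⟩
    b * x + a * y + g * u ≈⟨ +-congʳ (+-comm (b * x) (a * y)) ⟩
    a * y + b * x + g * u ∎

  module _ {n} (G : Subset n) {value cost u y z : Fin n → Carrier} {price gap : Carrier}
    (0≤price : 0# ≤ price) (0≤gap : 0# ≤ gap)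
    (value≤ : ∀ i → i ∈ G → value i ≤ price * cost i + gap)
    (value≥ : ∀ i → i ∈ G → price * cost i ≤ value i + gap)
    (y-bounds : ∀ i → i ∈ G → 0# ≤ y i × y i ≤ u i)
    (z-bounds : ∀ i → i ∈ G → 0# ≤ z i × z i ≤ u i)
    where

    -- Weak duality with `price` as the multiplier of the cost constraint. The exchange inequality
    -- is applied to each item with `a = value i` and `b = price * cost i`; after summation the
    -- nonnegative price carries over the comparison of total costs.
    priced-gap-≤ : sumOver G (λ i → cost i * z i) ≤ sumOver G (λ i → cost i * y i) →
                   sumOver G (λ i → value i * z i) - sumOver G (λ i → value i * y i)
                     ≤ gap * sumOver G u
    -- The priced cost of `y` is added on both sides and cancelled at the end, so that everything in
    -- between is free of subtraction.
    priced-gap-≤ cost-z≤cost-y = x≤y+z⇒x-y≤z (+-cancelʳ-≤ (price * C y) (begin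
      V z + price * C y
        ≈⟨ sumOver-value+price z y ⟨
      sumOver G (λ i → value i * z i + price * (cost i * y i))
        ≤⟨ sumOver-mono G pointwise ⟩
      sumOver G (λ i → (value i * y i + price * (cost i * z i)) + gap * u i)
        ≈⟨ trans (sumOver-+ G _ _) (+-cong (sumOver-value+price y z) (sumOver-*ˡ G gap u)) ⟩
      (V y + price * C z) + gap * sumOver G u
        ≤⟨ +-monoˡ-≤ _ (+-monoʳ-≤ (V y) (*-monoˡ-≤ 0≤price cost-z≤cost-y)) ⟩
      (V y + price * C y) + gap * sumOver G u
        ≈⟨ solve 3 (λ a b c → a :+ b :+ c := a :+ c :+ b) refl (V y) (price * C y) (gap * sumOver G u) ⟩
      (V y + gap * sumOver G u) + price * C y ∎))
      where
      V C : (Fin n → Carrier) → Carrier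
      V f = sumOver G (λ i → value i * f i)
      C f = sumOver G (λ i → cost i * f i)

      sumOver-value+price : ∀ f g →
        sumOver G (λ i → value i * f i + price * (cost i * g i)) ≈ V f + price * C g
      sumOver-value+price f g =
        trans (sumOver-+ G _ _) (+-congˡ (sumOver-*ˡ G price (λ i → cost i * g i)))

      pointwise : ∀ i → i ∈ G → value i * z i + price * (cost i * y i)
                              ≤ value i * y i + price * (cost i * z i) + gap * u i
      pointwise i i∈G = begin
        value i * z i + price * (cost i * y i)
          ≈⟨ +-congˡ (*-assoc price (cost i) (y i)) ⟨
        value i * z i + price * cost i * y i
          ≤⟨ swap-≤ (value≤ i i∈G) (value≥ i i∈G) 0≤gap
               (proj₁ (z-bounds i i∈G)) (proj₂ (z-bounds i i∈G))
               (proj₁ (y-bounds i i∈G)) (proj₂ (y-bounds i i∈G)) ⟩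
        value i * y i + price * cost i * z i + gap * u i
          ≈⟨ +-congʳ (+-congˡ (*-assoc price (cost i) (z i))) ⟩
        value i * y i + price * (cost i * z i) + gap * u i ∎

  -- The midpoint price and the relative spread of costs.

  module MidpointPrice {lo hi v̂ : Carrier} (0<lo : 0# < lo) (lo≤hi : lo ≤ hi) (0≤v̂ : 0# ≤ v̂) where

    0<hi+lo : 0# < hi + lo
    0<hi+lo = <-≤-trans 0<lo (≤-trans (x≤x+y (≤-trans (proj₁ 0<lo) lo≤hi))
                                      (≤-reflexive (+-comm lo hi)))

    -- `price` is `v̂` divided by the midpoint `(hi + lo) / 2`, written as `θ + θ` to avoid halving.
    -- `ρ` is the half-width of the interval from `lo` to `hi` relative to that midpoint.
    θ spread ρ price : Carrier
    θ      = v̂ / (hi + lo)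
    spread = hi - lo
    ρ      = spread / (hi + lo)
    price  = θ + θ

    0≤θ : 0# ≤ θ
    0≤θ = /-nonNeg 0≤v̂ 0<hi+lo

    0≤price : 0# ≤ price
    0≤price = +-nonNeg 0≤θ 0≤θ

    0≤ρ : 0# ≤ ρ
    0≤ρ = /-nonNeg (x≤y⇒0≤y-x lo≤hi) 0<hi+lo

    θ*[hi+lo]≈v̂ : θ * (hi + lo) ≈ v̂
    θ*[hi+lo]≈v̂ = x/y*y≈x v̂ 0<hi+lo

    θ*spread≈v̂*ρ : θ * spread ≈ v̂ * ρ
    θ*spread≈v̂*ρ = solve 3 (λ a b c → a :* b :* c := a :* (c :* b)) refl v̂ ((hi + lo) ⁻¹) spread

    -- The worst case is `w = lo`, where `price * lo` falls short of `v̂` by exactly `θ * spread`.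
    v̂≤price*w+v̂*ρ : ∀ {w} → lo ≤ w → v̂ ≤ price * w + v̂ * ρ
    v̂≤price*w+v̂*ρ {w} lo≤w = begin
      v̂                           ≈⟨ θ*[hi+lo]≈v̂ ⟨
      -- Writing `hi` as `spread + lo` exposes two copies of `lo`, each of which can be raised to
      -- `w`.
      θ * (hi + lo)               ≈⟨ *-congˡ (+-congʳ ([y-x]+x≈y lo hi)) ⟨
      θ * (spread + lo + lo)      ≤⟨ *-monoˡ-≤ 0≤θ (+-mono-≤ (+-monoʳ-≤ spread lo≤w) lo≤w) ⟩
      θ * (spread + w + w)        ≈⟨ solve 3 (λ θ s w → θ :* (s :+ w :+ w)
                                       := (θ :+ θ) :* w :+ θ :* s) refl θ spread w ⟩
      price * w + θ * spread      ≈⟨ +-congˡ θ*spread≈v̂*ρ ⟩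
      price * w + v̂ * ρ           ∎

    -- The worst case is `w = hi`, where `price * hi` exceeds `v̂` by exactly `θ * spread`.
    price*w≤v̂+v̂*ρ : ∀ {w} → w ≤ hi → price * w ≤ v̂ + v̂ * ρ
    price*w≤v̂+v̂*ρ {w} w≤hi = begin
      price * w                   ≤⟨ *-monoˡ-≤ 0≤price w≤hi ⟩
      price * hi                  ≈⟨ solve 2 (λ θ h → (θ :+ θ) :* h := θ :* (h :+ h)) refl θ hi ⟩
      θ * (hi + hi)               ≈⟨ *-congˡ (+-congˡ (x+[y-x]≈y lo hi)) ⟨
      θ * (hi + (lo + spread))    ≈⟨ solve 4 (λ θ h l s → θ :* (h :+ (l :+ s))
                                       := θ :* (h :+ l) :+ θ :* s) refl θ hi lo spread ⟩
      θ * (hi + lo) + θ * spread  ≈⟨ +-cong θ*[hi+lo]≈v̂ θ*spread≈v̂*ρ ⟩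
      v̂ + v̂ * ρ                   ∎

  -- Passing through the reference point `r` costs `b` twice, so the numerator is at most `b + b`;
  -- the denominator is at least `m + m`, and the two factors of two cancel.
  relative-spread-≤ : ∀ {m lo hi r b} → 0# < m → m ≤ lo → m ≤ hi → 0# ≤ b →
                      hi ≤ r + b → r ≤ lo + b →
                      (hi - lo) / (hi + lo) ≤ b / m
  relative-spread-≤ {m} {lo} {hi} {r} {b} 0<m m≤lo m≤hi 0≤b hi≤r+b r≤lo+b =
    x≤y*z⇒x/z≤y 0<hi+lo (begin
      hi - lo                 ≤⟨ x≤y+z⇒x-y≤z hi≤lo+[b+b] ⟩
      b + b                   ≈⟨ +-cong (x/y*y≈x b 0<m) (x/y*y≈x b 0<m) ⟨
      b / m * m + b / m * m   ≈⟨ distribˡ (b / m) m m ⟨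
      b / m * (m + m)         ≤⟨ *-monoˡ-≤ (/-nonNeg 0≤b 0<m) (+-mono-≤ m≤hi m≤lo) ⟩
      b / m * (hi + lo)       ∎)
    where
    0<hi+lo : 0# < hi + lo
    0<hi+lo = <-≤-trans 0<m (≤-trans m≤hi (x≤x+y (≤-trans (proj₁ 0<m) m≤lo)))

    hi≤lo+[b+b] : hi ≤ lo + (b + b)
    hi≤lo+[b+b] = begin
      hi           ≤⟨ hi≤r+b ⟩
      r + b        ≤⟨ +-monoˡ-≤ b r≤lo+b ⟩
      lo + b + b   ≈⟨ +-assoc lo b b ⟩
      lo + (b + b) ∎

-- Uniform linear dependence on the tolerance.

module WaterFilling {c ℓ₁ ℓ₂ a ℓ} (ℝ : Reals c ℓ₁ ℓ₂) (I : Instance ℝ a ℓ) where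
  open Reals ℝ
  open Instance I
  open OrderedFieldProperties orderedField
  open CommutativeRing commutativeRing
    using (commutativeSemiring; refl; sym; +-congʳ; *-comm)
  open TotalOrder totalOrder
    using (poset)
    renaming (reflexive to ≤-reflexive; trans to ≤-trans)
  open Solver commutativeSemiring using (solve; _:+_; _:*_; _:=_)
  open PartialOrderReasoning poset
  open MetricGrouping

  0≤v : ∀ x → 0# ≤ v x
  0≤v x = proj₁ (0<v x)

  -- The coefficient of group size times `δ` in the final bound, kept as a function of the
  -- representative value so that it can be compared with its value at `vmax`.
  constant : Carrier → Carrier
  constant x = x * L_w / wmin + Lᵥ

  constant-nonNeg : ∀ {x} → 0# ≤ x → 0# ≤ constant x
  constant-nonNeg 0≤x =
    +-nonNeg (/-nonNeg (*-nonNeg 0≤x (proj₁ w-lipschitz)) 0<wmin) (proj₁ v-lipschitz)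

  -- Group sizes are at most `n` and representative values at most `vmax`. The resulting factor of
  -- `δ` depends on the instance alone, so one constant serves all tolerances, groupings and groups.
  linear-bound : ∀ δ (𝒢 : MetricGrouping δ) k →
    abs (fromℕ ∣ group 𝒢 k ∣ * constant (v (rep 𝒢 k)) * δ) ≤ fromℕ n * constant vmax * δ
  linear-bound δ 𝒢 k = begin
    abs (N * K * δ)             ≤⟨ abs-nonNeg (*-nonNeg (*-nonNeg 0≤N 0≤K) 0≤δ) ⟩
    N * K * δ                   ≤⟨ *-monoʳ-≤ 0≤δ (*-monoʳ-≤ 0≤K (fromℕ-mono-≤ (∣p∣≤n (group 𝒢 k)))) ⟩
    fromℕ n * K * δ             ≤⟨ *-monoʳ-≤ 0≤δ (*-monoˡ-≤ (fromℕ-nonNeg n) K≤constant-vmax) ⟩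
    fromℕ n * constant vmax * δ ∎
    where
    N K : Carrier
    N = fromℕ ∣ group 𝒢 k ∣
    K = constant (v (rep 𝒢 k))
    0≤δ : 0# ≤ δ
    0≤δ = proj₁ (0<δ 𝒢)
    0≤N : 0# ≤ N
    0≤N = fromℕ-nonNeg ∣ group 𝒢 k ∣
    0≤K : 0# ≤ K
    0≤K = constant-nonNeg (0≤v (rep 𝒢 k))
    K≤constant-vmax : K ≤ constant vmax
    K≤constant-vmax = +-monoˡ-≤ Lᵥ (*-monoʳ-≤ (⁻¹-nonNeg 0<wmin)
                        (*-monoʳ-≤ (proj₁ w-lipschitz) (v≤vmax (rep 𝒢 k))))

  lipschitz-near : ∀ {L f x y δ} → IsLipschitz L f → d x y ≤ δ → abs (f x - f y) ≤ L * δ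
  lipschitz-near {x = x} {y} (0≤L , lip) dxy≤δ = ≤-trans (lip x y) (*-monoˡ-≤ 0≤L dxy≤δ)

  -- The chain of bounds for one group.

  module Group {δ} (𝒢 : MetricGrouping δ) k {w⁻ w⁺}
    (minimum : IsMinimum (group 𝒢 k) cost w⁻) (maximum : IsMaximum (group 𝒢 k) cost w⁺) where

    G : Subset n
    G = group 𝒢 k

    v̂ ŵ εᵥ ε_w U N ρ : Carrier
    v̂   = v (rep 𝒢 k)
    ŵ   = w (rep 𝒢 k)
    εᵥ  = Lᵥ * δ
    ε_w = L_w * δ
    U   = totalCeiling G
    N   = fromℕ ∣ G ∣
    ρ   = (w⁺ - w⁻) / (w⁺ + w⁻)

    0≤δ : 0# ≤ δ
    0≤δ = proj₁ (0<δ 𝒢)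

    0≤εᵥ : 0# ≤ εᵥ
    0≤εᵥ = *-nonNeg (proj₁ v-lipschitz) 0≤δ

    wmin≤cost-bound : ∀ {x} → (∃[ i ] i ∈ G × x ≈ cost i) → wmin ≤ x
    wmin≤cost-bound (i , _ , x≈wi) = ≤-trans (wmin≤w (attribute i)) (≤-reflexive (sym x≈wi))

    wmin≤w⁻ : wmin ≤ w⁻
    wmin≤w⁻ = wmin≤cost-bound (proj₁ minimum)

    wmin≤w⁺ : wmin ≤ w⁺
    wmin≤w⁺ = wmin≤cost-bound (proj₁ maximum)

    w⁻≤w⁺ : w⁻ ≤ w⁺
    w⁻≤w⁺ with proj₁ maximum
    ... | i , i∈G , w⁺≈wi = ≤-trans (proj₂ minimum i i∈G) (≤-reflexive (sym w⁺≈wi))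

    module Price = MidpointPrice (<-≤-trans 0<wmin wmin≤w⁻) w⁻≤w⁺ (0≤v (rep 𝒢 k))
    open Price using (price; 0≤price; 0≤ρ)

    -- The `κ` of the proof idea.
    gap : Carrier
    gap = v̂ * ρ + εᵥ

    0≤gap : 0# ≤ gap
    0≤gap = +-nonNeg (*-nonNeg (0≤v (rep 𝒢 k)) 0≤ρ) 0≤εᵥ

    value-near : ∀ i → i ∈ G → abs (value i - v̂) ≤ εᵥ
    value-near i i∈G = lipschitz-near v-lipschitz (close 𝒢 k i i∈G)

    cost-near : ∀ i → i ∈ G → abs (cost i - ŵ) ≤ ε_w
    cost-near i i∈G = lipschitz-near w-lipschitz (close 𝒢 k i i∈G)

    -- Two errors add up: `εᵥ` for moving from the item's value to `v̂`, and `v̂ * ρ` for moving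
    -- from `v̂` to the priced cost, whose `cost i` is at least `w⁻`.
    value≤ : ∀ i → i ∈ G → value i ≤ price * cost i + gap
    value≤ i i∈G = begin
      value i                         ≤⟨ abs[x-y]≤z⇒x≤y+z (value-near i i∈G) ⟩
      v̂ + εᵥ                          ≤⟨ +-monoˡ-≤ εᵥ (Price.v̂≤price*w+v̂*ρ (proj₂ minimum i i∈G)) ⟩
      price * cost i + v̂ * ρ + εᵥ     ≈⟨ solve 3 (λ a b c → a :+ b :+ c := a :+ (b :+ c)) refl
                                           (price * cost i) (v̂ * ρ) εᵥ ⟩
      price * cost i + gap            ∎

    value≥ : ∀ i → i ∈ G → price * cost i ≤ value i + gap
    value≥ i i∈G = begin
      price * cost i             ≤⟨ Price.price*w≤v̂+v̂*ρ (proj₂ maximum i i∈G) ⟩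
      v̂ + v̂ * ρ                  ≤⟨ +-monoˡ-≤ (v̂ * ρ) (abs[x-y]≤z⇒y≤x+z (value-near i i∈G)) ⟩
      value i + εᵥ + v̂ * ρ       ≈⟨ solve 3 (λ a b c → a :+ b :+ c := a :+ (c :+ b)) refl
                                      (value i) εᵥ (v̂ * ρ) ⟩
      value i + gap              ∎

    gap*U≈ : gap * U ≈ v̂ * U * ρ + εᵥ * U
    gap*U≈ = solve 4 (λ v U r e → (v :* r :+ e) :* U := v :* U :* r :+ e :* U) refl v̂ U ρ εᵥ

    -- The duality bound with `y` the water-filling allocation; the share `s` links the two total
    -- costs, bounding that of `z` and equalling that of `y`.
    loss-≤ : ∀ {s z ζ} → IsFeasible G s z → IsWaterLevel G s ζ →
             intraGroupLoss G z ζ ≤ v̂ * U * ρ + εᵥ * U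
    loss-≤ {s} {z} {ζ} (z-bounds , cost-z≤s) (0≤ζ , _ , cost-wf≈s) =
      ≤-trans
        (priced-gap-≤ G 0≤price 0≤gap value≤ value≥
          (λ i _ → ⊓-nonNeg (0≤u i) 0≤ζ , ⊓-≤ˡ (u i) ζ) z-bounds
          (≤-trans cost-z≤s (≤-reflexive (sym cost-wf≈s))))
        (≤-reflexive gap*U≈)

    ceiling-bound-≤ : v̂ * U * ρ + εᵥ * U ≤ N * gap
    ceiling-bound-≤ = begin
      v̂ * U * ρ + εᵥ * U ≈⟨ gap*U≈ ⟨
      gap * U            ≤⟨ *-monoˡ-≤ 0≤gap (sumOver-≤-∣∣ G u u≤1) ⟩
      gap * N            ≈⟨ *-comm gap N ⟩
      N * gap            ∎

    -- Both extremes are attained by items of the group, hence lie within `ε_w` of the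
    -- representative's cost `ŵ`, and both are at least `wmin`.
    ρ≤ : ρ ≤ ε_w / wmin
    ρ≤ with proj₁ minimum | proj₁ maximum
    ... | i , i∈G , w⁻≈wi | j , j∈G , w⁺≈wj =
      relative-spread-≤ 0<wmin wmin≤w⁻ wmin≤w⁺ (*-nonNeg (proj₁ w-lipschitz) 0≤δ)
        (≤-trans (≤-reflexive w⁺≈wj) (abs[x-y]≤z⇒x≤y+z (cost-near j j∈G)))
        (≤-trans (abs[x-y]≤z⇒y≤x+z (cost-near i i∈G))
                 (≤-reflexive (+-congʳ (sym w⁻≈wi))))

    tolerance-bound-≤ : N * gap ≤ N * constant v̂ * δ
    tolerance-bound-≤ = begin
      N * gap                          ≤⟨ *-monoˡ-≤ (fromℕ-nonNeg ∣ G ∣)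
                                            (+-monoˡ-≤ εᵥ (*-monoˡ-≤ (0≤v (rep 𝒢 k)) ρ≤)) ⟩
      -- Each of `ε_w` and `εᵥ` carries one factor `δ`, which is pulled out; the inverse of `wmin`
      -- is an atom for the solver.
      N * (v̂ * (ε_w / wmin) + εᵥ)      ≈⟨ solve 6 (λ N v Lw δ i Lv →
                                            N :* (v :* (Lw :* δ :* i) :+ Lv :* δ)
                                              := N :* (v :* Lw :* i :+ Lv) :* δ)
                                            refl N v̂ L_w δ (wmin ⁻¹) Lᵥ ⟩
      N * constant v̂ * δ               ∎

theorem8 :
  ∀ {c ℓ₁ ℓ₂ a ℓ} (ℝ : Reals c ℓ₁ ℓ₂) (I : Instance ℝ a ℓ) →
  let open Reals ℝ
      open Instance I
      open MetricGrouping
  in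
  (∀ δ (𝒢 : MetricGrouping δ) k →
    let G  = group 𝒢 k
        v̂  = v (rep 𝒢 k)
        εᵥ = Lᵥ * δ
        U  = totalCeiling G
        N  = fromℕ ∣ G ∣
    in
    ∀ w⁻ w⁺ → IsMinimum G cost w⁻ → IsMaximum G cost w⁺ →
    ∀ s → 0# ≤ s → s ≤ fullCost G →
    ∀ z ζ → IsOptimal G s z → IsWaterLevel G s ζ →
    let ρ = (w⁺ - w⁻) / (w⁺ + w⁻) in
      (intraGroupLoss G z ζ ≤ v̂ * U * ρ + εᵥ * U)
    × (v̂ * U * ρ + εᵥ * U ≤ N * (v̂ * ρ + εᵥ))
    × (N * (v̂ * ρ + εᵥ) ≤ N * ((v̂ * L_w) / wmin + Lᵥ) * δ))
  ×
  (∃[ C ] ∀ δ (𝒢 : MetricGrouping δ) k →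
    abs (fromℕ ∣ group 𝒢 k ∣ * ((v (rep 𝒢 k) * L_w) / wmin + Lᵥ) * δ) ≤ C * δ)
theorem8 ℝ I =
    (λ δ 𝒢 k w⁻ w⁺ minimum maximum s _ _ z ζ optimal level →
      let open Group 𝒢 k minimum maximum in
      loss-≤ (proj₁ optimal) level , ceiling-bound-≤ , tolerance-bound-≤)
  -- Unification with `linear-bound` supplies the witness `fromℕ n * constant vmax` for `C`.
  , (_ , linear-bound)
  where open WaterFilling ℝ I
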